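{- Let $X$ be an $(r,s,t)$-element circulant digraph on $n$ vertices. Then $X$ is singular if 1. $\gcd(n,s,r) > 1$, or 2. $\gcd(n,s) = 1$ and one of the following conditions holds: (a) there exists an integer $d \ge 2$ such that $d \mid t$ and $s = \ell r$, for some positive integer $\ell \equiv -1 \pmod d$; (b) $n$ is even, there exists an even integer $d$ such that $r+t$ is an odd multiple of $\frac{d}{2}$ and $s = \ell r$, for some positive integer $\ell \equiv 1 \pmod d$.
   Context: An $n \times n$ matrix is circulant if each row after the first is obtained by cyclically shifting the previous row one position to the right; it is thus determined by its first row. A digraph (loops allowed) is circulant if its adjacency matrix is circulant, and it is called singular if its adjacency matrix is singular. For a positive integer $n$ and non-negative integers $r,s,t$ with $r+s+t\le n$, the $(r,s,t)$-element circulant digraph on $n$ vertices is the digraph whose adjacency matrix is the circulant matrix with first row $$[\underbrace{1,\ldots,1}_{r},\ \underbrace{0,\ldots,0}_{t},\ \underbrace{1,\ldots,1}_{s},\ \underbrace{0,\ldots,0}_{n-(r+t+s)}].$$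
   Formalization: The hypothesis that d divides n is added in 2(a) and 2(b); without it the claim fails, e.g. 2(a) with n=5, r=s=1, t=2, d=2, ℓ=1 (determinant 2) and 2(b) with n=10, r=s=t=1, d=4, ℓ=1 (determinant 4). -}

module Defs where

open import Algebra.Definitions using (Invertible)
open import Data.Bool.Base using (Bool; _∧_; _∨_; if_then_else_)
open import Data.Fin.Base using (Fin; zero; suc; toℕ; fromℕ; inject₁)
open import Data.Fin.Properties using (_≟_)
open import Data.Integer.Base as ℤ using (ℤ)
import Data.Integer.Divisibility as ℤ
open import Data.Nat.Base using (ℕ; _+_; _≤ᵇ_; _<ᵇ_)
open import Data.Nat.GeneralisedArithmetic using (iterate)
open import Data.Rational.Base using (ℚ; 0ℚ; 1ℚ; _*_)
open import Data.Rational.Properties using (+-0-commutativeMonoid)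
open import Data.Vec.Functional using (Vector)
open import Level using (0ℓ)
open import Relation.Binary.Core using (Rel)
open import Relation.Binary.PropositionalEquality.Core using (_≡_)
open import Relation.Nullary.Decidable.Core using (⌊_⌋)
open import Relation.Nullary.Negation.Core using (¬_)

open import Algebra.Properties.CommutativeMonoid.Sum +-0-commutativeMonoid
  using (sum)

SquareMatrix : ℕ → Set
SquareMatrix n = Fin n → Fin n → ℚ

infix  4 _≈ᴹ_
infixl 7 _*ᴹ_

_≈ᴹ_ : ∀ {n} → Rel (SquareMatrix n) 0ℓ
A ≈ᴹ B = ∀ i j → A i j ≡ B i j

_*ᴹ_ : ∀ {n} → SquareMatrix n → SquareMatrix n → SquareMatrix n
(A *ᴹ B) i j = sum (λ k → A i k * B k j)

1ᴹ : ∀ {n} → SquareMatrix n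
1ᴹ i j = if ⌊ i ≟ j ⌋ then 1ℚ else 0ℚ

-- Invertibility of a rational matrix does not depend on whether the inverse
-- is sought over ℚ, ℝ or ℂ.
SingularMatrix : ∀ {n} → SquareMatrix n → Set
SingularMatrix A = ¬ Invertible _≈ᴹ_ 1ᴹ _*ᴹ_ A

-- Loops are allowed: X i i may be true.
Digraph : ℕ → Set
Digraph n = Fin n → Fin n → Bool

adjacencyMatrix : ∀ {n} → Digraph n → SquareMatrix n
adjacencyMatrix X i j = if X i j then 1ℚ else 0ℚ

Singular : ∀ {n} → Digraph n → Set
Singular X = SingularMatrix (adjacencyMatrix X)

cyclicPred : ∀ {n} → Fin n → Fin n
cyclicPred zero    = fromℕ _
cyclicPred (suc i) = inject₁ i

shiftRight : ∀ {n} {A : Set} → Vector A n → Vector A n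
shiftRight row j = row (cyclicPred j)

circulant : ∀ {n} {A : Set} → Vector A n → Fin n → Fin n → A
circulant row i = iterate shiftRight row (toℕ i)

-- r ones, t zeros, s ones, and zeros up to length n.
elementRow : ∀ n (r s t : ℕ) → Vector Bool n
elementRow n r s t j =
  (toℕ j <ᵇ r) ∨ ((r + t ≤ᵇ toℕ j) ∧ (toℕ j <ᵇ r + t + s))

elementCirculantDigraph : ∀ n (r s t : ℕ) → Digraph n
elementCirculantDigraph n r s t = circulant (elementRow n r s t)

infix 4 _≡[mod_]_

_≡[mod_]_ : ℤ → ℤ → ℤ → Set
a ≡[mod d ] b = d ℤ.∣ a ℤ.- b

Even Odd : ℤ → Set
Even a = ℤ.+ 2 ℤ.∣ a
Odd  a = ¬ Even a

-- To avoid roots of unity, a rational kernel vector is exhibited. For an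
-- n-periodic g, the vector v i = g i − g (i + 1) makes every row of the matrix
-- telescope over its two blocks of ones:
-- (A v) i = g i − g (i + r) + g (i + r + t) − g (i + r + t + s).
-- This vanishes for g = [d ∣ i] in cases 1 (with d the gcd) and 2(a), and for
-- any g with g (i + d/2) = − g i in case 2(b). If A were invertible, v would be
-- zero and g constant, which it is not.
module Submission where

open import Defs
open import Algebra.Bundles using (CommutativeRing)
open import Algebra.Definitions using (Invertible)
open import Data.Bool.Base using (Bool; true; false; _∧_; _∨_; if_then_else_)
open import Data.Fin.Base using (Fin; zero; suc; toℕ; fromℕ; fromℕ<; inject₁)
open import Data.Fin.Properties
  using (_≟_; toℕ<n; toℕ-fromℕ; toℕ-fromℕ<; toℕ-inject₁)
open import Data.Integer.Base as ℤ using (ℤ; +_; -1ℤ; 1ℤ)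
open import Data.Integer.Divisibility as ℤ using (_∣_)
import Data.Integer.Divisibility.Signed as Signed
import Data.Integer.DivMod as ℤ
import Data.Integer.Properties as ℤ
open import Data.Nat.Base
  using (ℕ; zero; suc; NonZero; _+_; _*_; _∸_; _≤_; _<_; _≤ᵇ_; _<ᵇ_; s≤s; >-nonZero⁻¹; ≢-nonZero; ≢-nonZero⁻¹)
import Data.Nat.Divisibility as ℕ
import Data.Nat.DivMod as ℕ
open import Data.Nat.GCD using (gcd; gcd[m,n]∣m; gcd[m,n]∣n)
open import Data.Nat.GeneralisedArithmetic using (iterate)
import Data.Nat.Properties as ℕ
open import Data.Nat.Tactic.RingSolver using (solve-∀)
open import Data.Product.Base using (∃-syntax; _×_; _,_)
open import Data.Rational.Base as ℚ using (ℚ; 0ℚ; 1ℚ)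
import Data.Rational.Properties as ℚ
open import Data.Rational.Solver using (module +-*-Solver)
open import Data.Sum.Base using (_⊎_; inj₁; inj₂)
open import Data.Vec.Functional using (Vector)
open import Function.Base using (_∘_)
open import Function.Bundles using (mk⇔)
open import Relation.Binary.PropositionalEquality
  using (_≡_; _≢_; refl; sym; trans; cong; cong₂; subst; module ≡-Reasoning)
open import Relation.Nullary.Decidable using (does; isYes≗does; dec-true; dec-false; does-⇔)
open import Relation.Nullary.Negation.Core using (¬_; contradiction)

open import Algebra.Properties.CommutativeMonoid.Sum ℚ.+-0-commutativeMonoid
open import Algebra.Properties.Group ℚ.+-0-group using (⁻¹-involutive; x∙y⁻¹≈ε⇒x≈y)
open import Algebra.Properties.Semiring.Sum
  (CommutativeRing.semiring ℚ.+-*-commutativeRing)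
  using (*-distribˡ-sum; *-distribʳ-sum)

open ≡-Reasoning

-- Finite sums of rationals.

bit : Bool → ℚ
bit b = if b then 1ℚ else 0ℚ

sum-zero : ∀ {n} {f : Vector ℚ n} → (∀ j → f j ≡ 0ℚ) → sum f ≡ 0ℚ
sum-zero {n} f≡0 = trans (sum-cong-≗ f≡0) (sum-replicate-zero n)

sum-+ : ∀ m n (f : ℕ → ℚ) →
  sum {m + n} (λ j → f (toℕ j)) ≡
  sum {m} (λ j → f (toℕ j)) ℚ.+ sum {n} (λ j → f (m + toℕ j))
sum-+ zero    n f = sym (ℚ.+-identityˡ _)
sum-+ (suc m) n f =
  trans (cong (f 0 ℚ.+_) (sum-+ m n (f ∘ suc))) (sym (ℚ.+-assoc (f 0) _ _))

-- The start `a` is arbitrary because the second block of ones begins at `r + t`, and because the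
-- induction drops the first term and restarts at `suc a`.
sum-telescope : ∀ n a (g : ℕ → ℚ) →
  sum {n} (λ j → g (a + toℕ j) ℚ.- g (a + suc (toℕ j))) ≡ g a ℚ.- g (a + n)
sum-telescope zero a g =
  sym (trans (cong (λ i → g a ℚ.- g i) (ℕ.+-identityʳ a)) (ℚ.+-inverseʳ (g a)))
sum-telescope (suc n) a g = begin
  g (a + 0) ℚ.- g (a + 1) ℚ.+ rest
    ≡⟨ cong₂ (λ i k → g i ℚ.- g k ℚ.+ rest) (ℕ.+-identityʳ a) (ℕ.+-comm a 1) ⟩
  g a ℚ.- g (suc a) ℚ.+ rest
    ≡⟨ cong (g a ℚ.- g (suc a) ℚ.+_) (sum-cong-≗ {n} λ j → cong₂ (λ i k → g i ℚ.- g k)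
         (ℕ.+-suc a (toℕ j)) (ℕ.+-suc a (suc (toℕ j)))) ⟩
  g a ℚ.- g (suc a) ℚ.+ sum {n} (λ j → g (suc a + toℕ j) ℚ.- g (suc a + suc (toℕ j)))
    ≡⟨ cong (g a ℚ.- g (suc a) ℚ.+_) (sum-telescope n (suc a) g) ⟩
  g a ℚ.- g (suc a) ℚ.+ (g (suc a) ℚ.- g (suc (a + n)))
    ≡⟨ solve 3 (λ x y z → x :- y :+ (y :- z) := x :- z) refl (g a) (g (suc a)) _ ⟩
  g a ℚ.- g (suc (a + n))
    ≡⟨ cong (λ i → g a ℚ.- g i) (ℕ.+-suc a n) ⟨
  g a ℚ.- g (a + suc n) ∎
  where
  open +-*-Solver

  rest : ℚ
  rest = sum {n} (λ j → g (a + suc (toℕ j)) ℚ.- g (a + suc (suc (toℕ j))))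

-- Kernels of invertible matrices.

1ᴹ-sum : ∀ {n} (i : Fin n) (v : Vector ℚ n) → sum (λ j → 1ᴹ i j ℚ.* v j) ≡ v i
1ᴹ-sum zero v = begin
  1ℚ ℚ.* v zero ℚ.+ sum (λ j → 0ℚ ℚ.* v (suc j))
    ≡⟨ cong₂ ℚ._+_ (ℚ.*-identityˡ (v zero)) (sum-zero (λ j → ℚ.*-zeroˡ (v (suc j)))) ⟩
  v zero ℚ.+ 0ℚ
    ≡⟨ ℚ.+-identityʳ (v zero) ⟩
  v zero ∎
1ᴹ-sum (suc i) v = begin
  0ℚ ℚ.* v zero ℚ.+ sum (λ j → 1ᴹ (suc i) (suc j) ℚ.* v (suc j))
    -- The two decisions are compared through `does`, which computes past the successors.
    ≡⟨ cong₂ ℚ._+_ (ℚ.*-zeroˡ (v zero)) (sum-cong-≗ λ j → cong (λ b → bit b ℚ.* v (suc j))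
         (trans (isYes≗does (suc i ≟ suc j)) (sym (isYes≗does (i ≟ j))))) ⟩
  0ℚ ℚ.+ sum (λ j → 1ᴹ i j ℚ.* v (suc j))
    ≡⟨ cong (0ℚ ℚ.+_) (1ᴹ-sum i (v ∘ suc)) ⟩
  0ℚ ℚ.+ v (suc i)
    ≡⟨ ℚ.+-identityˡ (v (suc i)) ⟩
  v (suc i) ∎

-- A left inverse `B` gives v = (BA)v = B(Av) = 0. Exchanging the two sums is the associativity of
-- the matrix-vector product.
invertible⇒kernel-trivial : ∀ {n} {A : SquareMatrix n} {v : Vector ℚ n} →
  Invertible _≈ᴹ_ 1ᴹ _*ᴹ_ A → (∀ i → sum (λ j → A i j ℚ.* v j) ≡ 0ℚ) →
  ∀ i → v i ≡ 0ℚ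
invertible⇒kernel-trivial {n} {A} {v} (B , BA≈1 , _) Av≡0 i = begin
  v i                                                    ≡⟨ 1ᴹ-sum i v ⟨
  sum (λ j → 1ᴹ i j ℚ.* v j)                             ≡⟨ sum-cong-≗ (λ j → cong (ℚ._* v j) (BA≈1 i j)) ⟨
  sum (λ j → (B *ᴹ A) i j ℚ.* v j)                       ≡⟨ sum-cong-≗ (λ j → *-distribʳ-sum (v j) (λ k → B i k ℚ.* A k j)) ⟩
  sum (λ j → sum (λ k → B i k ℚ.* A k j ℚ.* v j))        ≡⟨ ∑-comm (λ j k → B i k ℚ.* A k j ℚ.* v j) ⟩
  sum (λ k → sum (λ j → B i k ℚ.* A k j ℚ.* v j))        ≡⟨ sum-cong-≗ (λ k → sum-cong-≗ (λ j → ℚ.*-assoc (B i k) (A k j) (v j))) ⟩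
  sum (λ k → sum (λ j → B i k ℚ.* (A k j ℚ.* v j)))      ≡⟨ sum-cong-≗ (λ k → *-distribˡ-sum (B i k) (λ j → A k j ℚ.* v j)) ⟨
  sum (λ k → B i k ℚ.* sum (λ j → A k j ℚ.* v j))        ≡⟨ sum-zero (λ k → trans (cong (B i k ℚ.*_) (Av≡0 k)) (ℚ.*-zeroʳ (B i k))) ⟩
  0ℚ                                                     ∎

-- Rows of the circulant matrix applied to a vector of differences.

shiftRight-sum : ∀ {n} (R : Vector Bool n) (v : ℕ → ℚ) → v n ≡ v 0 →
  sum (λ j → bit (shiftRight R j) ℚ.* v (toℕ j)) ≡
  sum (λ j → bit (R j) ℚ.* v (suc (toℕ j)))
shiftRight-sum {zero}  R v vn≡v0 = refl
shiftRight-sum {suc m} R v vn≡v0 = begin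
  bit (R (fromℕ m)) ℚ.* v 0 ℚ.+ sum (λ j → bit (R (inject₁ j)) ℚ.* v (suc (toℕ j)))
    -- Column 0 of the shifted row holds the last entry of `R`. Moved to the end, with `v 0` read as
    -- `v n`, it becomes the last term of the target sum.
    ≡⟨ ℚ.+-comm (bit (R (fromℕ m)) ℚ.* v 0) _ ⟩
  sum (λ j → bit (R (inject₁ j)) ℚ.* v (suc (toℕ j))) ℚ.+ bit (R (fromℕ m)) ℚ.* v 0
    ≡⟨ cong₂ ℚ._+_
         (sum-cong-≗ λ j → cong (λ i → bit (R (inject₁ j)) ℚ.* v (suc i)) (sym (toℕ-inject₁ j)))
         (cong (bit (R (fromℕ m)) ℚ.*_) (trans (sym vn≡v0) (cong (v ∘ suc) (sym (toℕ-fromℕ m))))) ⟩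
  sum (λ j → bit (R (inject₁ j)) ℚ.* v (suc (toℕ (inject₁ j))))
    ℚ.+ bit (R (fromℕ m)) ℚ.* v (suc (toℕ (fromℕ m)))
    ≡⟨ sum-init-last (λ j → bit (R j) ℚ.* v (suc (toℕ j))) ⟨
  sum (λ j → bit (R j) ℚ.* v (suc (toℕ j))) ∎

-- Each shift of the row is traded for a translation of `v`, so every row reduces to the first one.
-- A shift is removed when `v` is already translated by `k`, hence periodicity at every index.
iterate-shiftRight-sum : ∀ {n} k (R : Vector Bool n) (v : ℕ → ℚ) → (∀ i → v (i + n) ≡ v i) →
  sum (λ j → bit (iterate shiftRight R k j) ℚ.* v (toℕ j)) ≡
  sum (λ j → bit (R j) ℚ.* v (k + toℕ j))
iterate-shiftRight-sum zero    R v per = refl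
iterate-shiftRight-sum {n} (suc k) R v per =
  trans (iterate-shiftRight-sum k (shiftRight R) v per)
    (trans (shiftRight-sum R (λ i → v (k + i)) (trans (per k) (cong v (sym (ℕ.+-identityʳ k)))))
      (sum-cong-≗ λ j → cong (λ i → bit (R j) ℚ.* v i) (ℕ.+-suc k (toℕ j))))

-- Cut the row into blocks of lengths `r`, `t`, `s` and `u`. The blocks of zeros contribute nothing,
-- and each block of ones telescopes to the values of `g` at its two ends.
elementRow-sum : ∀ {n r s t} → r + s + t ≤ n → (g : ℕ → ℚ) →
  sum (λ j → bit (elementRow n r s t j) ℚ.* (g (toℕ j) ℚ.- g (suc (toℕ j)))) ≡
  (g 0 ℚ.- g r) ℚ.+ (g (r + t) ℚ.- g (r + t + s))
elementRow-sum {n} {r} {s} {t} r+s+t≤n g =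
  trans (cong (λ m → sum {m} (λ j → F (toℕ j))) n≡) (begin
  sum {r + (t + (s + u))} (λ j → F (toℕ j))
    ≡⟨ sum-+ r (t + (s + u)) F ⟩
  sum {r} (λ j → F (toℕ j)) ℚ.+ sum {t + (s + u)} (λ j → F (r + toℕ j))
    ≡⟨ cong (sum {r} (λ j → F (toℕ j)) ℚ.+_) (trans
         (sum-+ t (s + u) (λ j → F (r + j)))
         (cong (sum {t} (λ j → F (r + toℕ j)) ℚ.+_) (sum-+ s u (λ j → F (r + (t + j)))))) ⟩
  sum {r} (λ j → F (toℕ j)) ℚ.+ (sum {t} (λ j → F (r + toℕ j)) ℚ.+
    (sum {s} (λ j → F (r + (t + toℕ j))) ℚ.+ sum {u} (λ j → F (r + (t + (s + toℕ j))))))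
    ≡⟨ cong₂ ℚ._+_ block₁ (cong₂ ℚ._+_ block₂ (cong₂ ℚ._+_ block₃ block₄)) ⟩
  (g 0 ℚ.- g r) ℚ.+ (0ℚ ℚ.+ ((g (r + t) ℚ.- g (r + t + s)) ℚ.+ 0ℚ))
    ≡⟨ cong ((g 0 ℚ.- g r) ℚ.+_) (trans (ℚ.+-identityˡ _) (ℚ.+-identityʳ _)) ⟩
  (g 0 ℚ.- g r) ℚ.+ (g (r + t) ℚ.- g (r + t + s)) ∎)
  where
  -- Length of the trailing block of zeros; the bound makes the truncated subtraction exact.
  u = n ∸ (r + s + t)

  n≡ : n ≡ r + (t + (s + u))
  n≡ = trans (sym (ℕ.m+[n∸m]≡n r+s+t≤n)) (rearrange r s t u)
    where
    rearrange : ∀ a b c d → a + b + c + d ≡ a + (c + (b + d))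
    rearrange = solve-∀

  β : ℕ → Bool
  β i = (i <ᵇ r) ∨ ((r + t ≤ᵇ i) ∧ (i <ᵇ r + t + s))

  F : ℕ → ℚ
  F i = bit (β i) ℚ.* (g i ℚ.- g (suc i))

  F-on : ∀ {i} → β i ≡ true → F i ≡ g i ℚ.- g (suc i)
  F-on {i} eq = trans (cong (λ b → bit b ℚ.* (g i ℚ.- g (suc i))) eq) (ℚ.*-identityˡ _)

  F-off : ∀ {i} → β i ≡ false → F i ≡ 0ℚ
  F-off {i} eq = trans (cong (λ b → bit b ℚ.* (g i ℚ.- g (suc i))) eq) (ℚ.*-zeroˡ (g i ℚ.- g (suc i)))

  <-true : ∀ {i k} → i < k → (i <ᵇ k) ≡ true
  <-true {i} {k} = dec-true (i ℕ.<? k)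

  <-false : ∀ {i k} → k ≤ i → (i <ᵇ k) ≡ false
  <-false {i} {k} k≤i = dec-false (i ℕ.<? k) (ℕ.≤⇒≯ k≤i)

  ≤-true : ∀ {i k} → i ≤ k → (i ≤ᵇ k) ≡ true
  ≤-true {i} {k} = dec-true (i ℕ.≤? k)

  ≤-false : ∀ {i k} → k < i → (i ≤ᵇ k) ≡ false
  ≤-false {i} {k} k<i = dec-false (i ℕ.≤? k) (ℕ.<⇒≱ k<i)

  block₁ : sum {r} (λ j → F (toℕ j)) ≡ g 0 ℚ.- g r
  block₁ = trans
    (sum-cong-≗ {r} λ j → F-on {toℕ j} (cong
      (_∨ ((r + t ≤ᵇ toℕ j) ∧ (toℕ j <ᵇ r + t + s))) (<-true (toℕ<n j))))
    (sum-telescope r 0 g)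

  block₂ : sum {t} (λ j → F (r + toℕ j)) ≡ 0ℚ
  block₂ = sum-zero {t} λ j → F-off (cong₂ _∨_ (<-false (ℕ.m≤m+n r (toℕ j)))
    (cong (_∧ (r + toℕ j <ᵇ r + t + s)) (≤-false (ℕ.+-monoʳ-< r (toℕ<n j)))))

  block₃ : sum {s} (λ j → F (r + (t + toℕ j))) ≡ g (r + t) ℚ.- g (r + t + s)
  block₃ = trans
    (sum-cong-≗ {s} λ j → begin
      F (r + (t + toℕ j))
        ≡⟨ cong F (ℕ.+-assoc r t (toℕ j)) ⟨
      F (r + t + toℕ j)
        ≡⟨ F-on (cong₂ _∨_ (<-false (ℕ.≤-trans (ℕ.m≤m+n r t) (ℕ.m≤m+n (r + t) (toℕ j))))
             (cong₂ _∧_ (≤-true (ℕ.m≤m+n (r + t) (toℕ j))) (<-true (ℕ.+-monoʳ-< (r + t) (toℕ<n j))))) ⟩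
      g (r + t + toℕ j) ℚ.- g (suc (r + t + toℕ j))
        ≡⟨ cong (λ i → g (r + t + toℕ j) ℚ.- g i) (ℕ.+-suc (r + t) (toℕ j)) ⟨
      g (r + t + toℕ j) ℚ.- g (r + t + suc (toℕ j)) ∎)
    (sum-telescope s (r + t) g)

  block₄ : sum {u} (λ j → F (r + (t + (s + toℕ j)))) ≡ 0ℚ
  block₄ = sum-zero {u} λ j → trans
    (cong F (rearrange r t s (toℕ j)))
    (F-off (cong₂ _∨_ (<-false (ℕ.≤-trans (ℕ.m≤m+n r t)
        (ℕ.≤-trans (ℕ.m≤m+n (r + t) s) (ℕ.m≤m+n (r + t + s) (toℕ j)))))
      (cong₂ _∧_ (≤-true (ℕ.≤-trans (ℕ.m≤m+n (r + t) s) (ℕ.m≤m+n (r + t + s) (toℕ j))))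
        (<-false (ℕ.m≤m+n (r + t + s) (toℕ j))))))
    where
    rearrange : ∀ a b c d → a + (b + (c + d)) ≡ a + b + c + d
    rearrange = solve-∀

-- For g i = ω^i with ω^n = 1, this is ω^i (1 − ω) times the eigenvalue at ω.
blockBoundary : (r s t : ℕ) → (ℕ → ℚ) → ℕ → ℚ
blockBoundary r s t g i =
  (g i ℚ.- g (i + r)) ℚ.+ (g (i + (r + t)) ℚ.- g (i + (r + t + s)))

-- The differences `v` at indices below `n` link all of g 0, ..., g n, so an inverse would make `g`
-- constant up to and including `n`. Periodicity of `g` passes to `v`, which lets row shifts be
-- moved onto it.
telescoping-singular : ∀ {n r s t} → r + s + t ≤ n →
  (g : ℕ → ℚ) → (∀ i → g (i + n) ≡ g i) →
  (∀ i → blockBoundary r s t g i ≡ 0ℚ) →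
  ∀ {x} → x ≤ n → g 0 ≢ g x →
  Singular (elementCirculantDigraph n r s t)
telescoping-singular {n} {r} {s} {t} r+s+t≤n g per vanish {x} x≤n g0≢gx inv =
  g0≢gx (constant x x≤n)
  where
  v : ℕ → ℚ
  v i = g i ℚ.- g (suc i)

  Av≡0 : ∀ (i : Fin n) →
    sum (λ j → adjacencyMatrix (elementCirculantDigraph n r s t) i j ℚ.* v (toℕ j)) ≡ 0ℚ
  Av≡0 i = begin
    sum (λ j → bit (iterate shiftRight (elementRow n r s t) k j) ℚ.* v (toℕ j))
      ≡⟨ iterate-shiftRight-sum k (elementRow n r s t) v (λ i → cong₂ ℚ._-_ (per i) (per (suc i))) ⟩
    sum (λ j → bit (elementRow n r s t j) ℚ.* v (k + toℕ j))
      ≡⟨ sum-cong-≗ (λ j → cong (λ i → bit (elementRow n r s t j) ℚ.* (g (k + toℕ j) ℚ.- g i))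
           (ℕ.+-suc k (toℕ j))) ⟨
    sum (λ j → bit (elementRow n r s t j) ℚ.* (g (k + toℕ j) ℚ.- g (k + suc (toℕ j))))
      ≡⟨ elementRow-sum r+s+t≤n (λ i → g (k + i)) ⟩
    (g (k + 0) ℚ.- g (k + r)) ℚ.+ (g (k + (r + t)) ℚ.- g (k + (r + t + s)))
      ≡⟨ cong (λ i → (g i ℚ.- g (k + r)) ℚ.+ (g (k + (r + t)) ℚ.- g (k + (r + t + s)))) (ℕ.+-identityʳ k) ⟩
    (g k ℚ.- g (k + r)) ℚ.+ (g (k + (r + t)) ℚ.- g (k + (r + t + s)))
      ≡⟨ vanish k ⟩
    0ℚ ∎
    where k = toℕ i

  v≡0 : ∀ (i : Fin n) → v (toℕ i) ≡ 0ℚ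
  v≡0 = invertible⇒kernel-trivial {v = v ∘ toℕ} inv Av≡0

  constant : ∀ x → x ≤ n → g 0 ≡ g x
  constant zero    _   = refl
  constant (suc x) x<n = trans (constant x (ℕ.<⇒≤ x<n))
    (x∙y⁻¹≈ε⇒x≈y (g x) (g (suc x)) (subst (λ i → v i ≡ 0ℚ) (toℕ-fromℕ< x<n) (v≡0 (fromℕ< x<n))))

-- Periodic and antiperiodic test functions.

∣-period : ∀ {A : Set} {g : ℕ → A} {d m} → (∀ i → g (i + d) ≡ g i) →
  d ℕ.∣ m → ∀ i → g (i + m) ≡ g i
∣-period {g = g} {d} per (ℕ.divides-refl q) = go q
  where
  go : ∀ q i → g (i + q * d) ≡ g i
  go zero    i = cong g (ℕ.+-identityʳ i)
  go (suc q) i = trans (cong g (sym (ℕ.+-assoc i d (q * d)))) (trans (go q (i + d)) (per i))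

multipleIndicator : ℕ → ℕ → ℚ
multipleIndicator d i = bit (does (d ℕ.∣? i))

multipleIndicator-periodic : ∀ d i → multipleIndicator d (i + d) ≡ multipleIndicator d i
multipleIndicator-periodic d i = cong bit (does-⇔
  (mk⇔ (λ d∣i+d → ℕ.∣m+n∣m⇒∣n (subst (d ℕ.∣_) (ℕ.+-comm i d) d∣i+d) ℕ.∣-refl) (λ d∣i → ℕ.∣m∣n⇒∣m+n d∣i ℕ.∣-refl))
  (d ℕ.∣? (i + d)) (d ℕ.∣? i))

multipleIndicator-0 : ∀ d → multipleIndicator d 0 ≡ 1ℚ
multipleIndicator-0 d = cong bit (dec-true (d ℕ.∣? 0) (d ℕ.∣0))

multipleIndicator-∤ : ∀ {d i} → d ℕ.∤ i → multipleIndicator d i ≡ 0ℚ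
multipleIndicator-∤ {d} {i} d∤i = cong bit (dec-false (d ℕ.∣? i) d∤i)

-- `vanish` is asked of every `d`-periodic function, so that each case argues from periodicity
-- alone. The indicator of the multiples of `d` separates 0 from 1 because `d` exceeds 1.
periodic-singular : ∀ {n r s t d} .{{_ : NonZero n}} → r + s + t ≤ n → 1 < d → d ℕ.∣ n →
  (∀ {g : ℕ → ℚ} → (∀ i → g (i + d) ≡ g i) →
    ∀ i → blockBoundary r s t g i ≡ 0ℚ) →
  Singular (elementCirculantDigraph n r s t)
periodic-singular {n} {r} {s} {d = d} bound 1<d d∣n vanish =
  telescoping-singular {r = r} {s} bound g (∣-period per d∣n) (vanish per) (>-nonZero⁻¹ n)
    λ g0≡g1 → contradiction
      (trans (sym (multipleIndicator-0 d)) (trans g0≡g1 (multipleIndicator-∤ (ℕ.>⇒∤ 1<d))))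
      λ ()
  where
  g = multipleIndicator d
  per = multipleIndicator-periodic d

antiperiodic-singular : ∀ {n r s t h} .{{_ : NonZero n}} .{{_ : NonZero h}} → r + s + t ≤ n →
  h + h ℕ.∣ n →
  (∀ {g : ℕ → ℚ} → (∀ i → g (i + h) ≡ ℚ.- g i) →
    ∀ i → blockBoundary r s t g i ≡ 0ℚ) →
  Singular (elementCirculantDigraph n r s t)
antiperiodic-singular {n} {r} {s} {h = h} bound 2h∣n vanish =
  telescoping-singular {r = r} {s} bound g
    (∣-period (λ i → cong₂ ℚ._-_ (per i) (trans (cong δ (swap i h)) (per (i + h)))) 2h∣n)
    (vanish anti) h≤n
    -- The separating index is `h`: antiperiodicity gives g h = -g 0 = -1, while g 0 = 1.
    λ g0≡gh → contradiction (trans (sym g0≡1) (trans g0≡gh (trans (anti 0) (cong ℚ.-_ g0≡1)))) λ ()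
  where
  δ : ℕ → ℚ
  δ = multipleIndicator (h + h)

  -- Takes the value 1 at multiples of 2h, -1 at odd multiples of h, and 0 elsewhere.
  g : ℕ → ℚ
  g i = δ i ℚ.- δ (i + h)

  per : ∀ i → δ (i + (h + h)) ≡ δ i
  per = multipleIndicator-periodic (h + h)

  swap : ∀ i h → i + (h + h) + h ≡ i + h + (h + h)
  swap = solve-∀

  anti : ∀ i → g (i + h) ≡ ℚ.- g i
  anti i = begin
    δ (i + h) ℚ.- δ (i + h + h)   ≡⟨ cong (λ k → δ (i + h) ℚ.- δ k) (ℕ.+-assoc i h h) ⟩
    δ (i + h) ℚ.- δ (i + (h + h)) ≡⟨ cong (λ p → δ (i + h) ℚ.- p) (per i) ⟩
    δ (i + h) ℚ.- δ i             ≡⟨ solve 2 (λ x y → y :- x := :- (x :- y)) refl (δ i) (δ (i + h)) ⟩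
    ℚ.- g i                       ∎
    where open +-*-Solver

  h≤n : h ≤ n
  h≤n = ℕ.≤-trans (ℕ.m≤m+n h h) (ℕ.∣⇒≤ 2h∣n)

  g0≡1 : g 0 ≡ 1ℚ
  g0≡1 = cong₂ ℚ._-_ (multipleIndicator-0 (h + h))
    (multipleIndicator-∤ (ℕ.>⇒∤ (ℕ.m<m+n h (>-nonZero⁻¹ h))))

-- Parity and halving.

<2∧2∣⇒≡0 : ∀ {m} → m < 2 → 2 ℕ.∣ m → m ≡ 0
<2∧2∣⇒≡0 {zero}  _   _   = refl
<2∧2∣⇒≡0 {suc m} m<2 2∣m = contradiction 2∣m (ℕ.>⇒∤ m<2)

2∤⇒≡1+q*2 : ∀ {m} → ¬ 2 ℕ.∣ m → ∃[ q ] m ≡ 1 + q * 2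
2∤⇒≡1+q*2 {m} 2∤m with m ℕ.% 2 in eq | ℕ.m≡m%n+[m/n]*n m 2 | ℕ.m%n<n m 2
... | zero        | _  | _ = contradiction (ℕ.m%n≡0⇒n∣m m 2 eq) 2∤m
... | suc zero    | m≡ | _ = m ℕ./ 2 , m≡
... | suc (suc _) | _  | s≤s (s≤s ())

-- The remainder of `d` modulo 2 is even and below 2, hence 0, so the division is exact. Absolute
-- values appear because `d` may be negative.
even⇒∣d∣≡∣d/2∣*2 : ∀ d → Even d → ℤ.∣ d ∣ ≡ ℤ.∣ d ℤ./ + 2 ∣ * 2
even⇒∣d∣≡∣d/2∣*2 d 2∣d = trans (cong ℤ.∣_∣ d≡) (ℤ.abs-* q (+ 2))
  where
  q = d ℤ./ + 2
  ρ = d ℤ.% + 2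

  2∣ρ : 2 ℕ.∣ ρ
  2∣ρ = Signed.∣⇒∣ᵤ (Signed.∣m+n∣n⇒∣m {m = + ρ}
    (subst (+ 2 Signed.∣_) (ℤ.a≡a%n+[a/n]*n d (+ 2)) (Signed.∣ᵤ⇒∣ 2∣d))
    (Signed.∣n⇒∣m*n q Signed.∣-refl))

  d≡ : d ≡ q ℤ.* + 2
  d≡ = trans (ℤ.a≡a%n+[a/n]*n d (+ 2))
    (trans (cong (λ i → + i ℤ.+ q ℤ.* + 2) (<2∧2∣⇒≡0 (ℤ.n%d<d d (+ 2)) 2∣ρ)) (ℤ.+-identityˡ _))

-- The cases of the theorem.

gcd-singular : ∀ {n r s t} .{{_ : NonZero n}} → r + s + t ≤ n → 1 < gcd n (gcd s r) →
  Singular (elementCirculantDigraph n r s t)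
gcd-singular {n} {r} {s} {t} bound 1<d =
  periodic-singular {r = r} {s} bound 1<d (gcd[m,n]∣m n (gcd s r)) vanish
  where
  d = gcd n (gcd s r)

  d∣s : d ℕ.∣ s
  d∣s = ℕ.∣-trans (gcd[m,n]∣n n (gcd s r)) (gcd[m,n]∣m s r)

  d∣r : d ℕ.∣ r
  d∣r = ℕ.∣-trans (gcd[m,n]∣n n (gcd s r)) (gcd[m,n]∣n s r)

  vanish : ∀ {g : ℕ → ℚ} → (∀ i → g (i + d) ≡ g i) →
    ∀ i → blockBoundary r s t g i ≡ 0ℚ
  vanish {g} per i = begin
    (g i ℚ.- g (i + r)) ℚ.+ (g (i + (r + t)) ℚ.- g (i + (r + t + s)))
      -- Both block lengths are multiples of `d`, so the two blocks vanish separately.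
      ≡⟨ cong₂ (λ p q → (g i ℚ.- p) ℚ.+ (g (i + (r + t)) ℚ.- q)) (∣-period per d∣r i)
           (trans (cong g (sym (ℕ.+-assoc i (r + t) s))) (∣-period per d∣s (i + (r + t)))) ⟩
    (g i ℚ.- g i) ℚ.+ (g (i + (r + t)) ℚ.- g (i + (r + t)))
      ≡⟨ cong₂ ℚ._+_ (ℚ.+-inverseʳ (g i)) (ℚ.+-inverseʳ (g (i + (r + t)))) ⟩
    0ℚ ∎

-- Here the blocks cancel each other: modulo `d` the second starts where the first ends, since `d`
-- divides `t`, and ends where the first starts, since `d` divides `r + t + s`.
∣t-∣r+s-singular : ∀ {n r s t d} .{{_ : NonZero n}} → r + s + t ≤ n →
  1 < d → d ℕ.∣ n → d ℕ.∣ t → d ℕ.∣ r + s →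
  Singular (elementCirculantDigraph n r s t)
∣t-∣r+s-singular {n} {r} {s} {t} {d} bound 1<d d∣n d∣t d∣r+s =
  periodic-singular {r = r} {s} bound 1<d d∣n vanish
  where
  rearrange : ∀ r s t → r + t + s ≡ r + s + t
  rearrange = solve-∀

  d∣r+t+s : d ℕ.∣ r + t + s
  d∣r+t+s = subst (d ℕ.∣_) (sym (rearrange r s t)) (ℕ.∣m∣n⇒∣m+n d∣r+s d∣t)

  vanish : ∀ {g : ℕ → ℚ} → (∀ i → g (i + d) ≡ g i) →
    ∀ i → blockBoundary r s t g i ≡ 0ℚ
  vanish {g} per i = begin
    (g i ℚ.- g (i + r)) ℚ.+ (g (i + (r + t)) ℚ.- g (i + (r + t + s)))
      ≡⟨ cong₂ (λ p q → (g i ℚ.- g (i + r)) ℚ.+ (p ℚ.- q))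
           (trans (cong g (sym (ℕ.+-assoc i r t))) (∣-period per d∣t (i + r)))
           (∣-period per d∣r+t+s i) ⟩
    (g i ℚ.- g (i + r)) ℚ.+ (g (i + r) ℚ.- g i)
      ≡⟨ solve 2 (λ x y → (x :- y) :+ (y :- x) := con 0ℚ) refl (g i) (g (i + r)) ⟩
    0ℚ ∎
    where open +-*-Solver

-- Here `h` is half of the modulus and `m` is the surplus s - r. Translation by `r + t`, an odd
-- multiple of `h`, negates `g`, and translation by `m` fixes it, so the second block contributes -g
-- i + g (i + r), the negative of the first.
odd-multiple-singular : ∀ {n r s t h} .{{_ : NonZero n}} .{{_ : NonZero h}} → r + s + t ≤ n →
  h + h ℕ.∣ n → ∀ q m → r + t ≡ h + q * (h + h) → s ≡ r + m → h + h ℕ.∣ m →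
  Singular (elementCirculantDigraph n r s t)
odd-multiple-singular {n} {r} {s} {t} {h} bound 2h∣n q m r+t≡ s≡ 2h∣m =
  antiperiodic-singular {r = r} {s} bound 2h∣n vanish
  where
  module _ {g : ℕ → ℚ} (anti : ∀ i → g (i + h) ≡ ℚ.- g i) where
    per : ∀ i → g (i + (h + h)) ≡ g i
    per i = begin
      g (i + (h + h)) ≡⟨ cong g (ℕ.+-assoc i h h) ⟨
      g (i + h + h)   ≡⟨ anti (i + h) ⟩
      ℚ.- g (i + h)   ≡⟨ cong ℚ.-_ (anti i) ⟩
      ℚ.- (ℚ.- g i)   ≡⟨ ⁻¹-involutive (g i) ⟩
      g i             ∎

    shift-r+t : ∀ i → g (i + (r + t)) ≡ ℚ.- g i
    shift-r+t i = begin
      g (i + (r + t))           ≡⟨ cong (λ k → g (i + k)) r+t≡ ⟩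
      g (i + (h + q * (h + h))) ≡⟨ cong g (ℕ.+-assoc i h (q * (h + h))) ⟨
      g (i + h + q * (h + h))   ≡⟨ ∣-period per (ℕ.n∣m*n q) (i + h) ⟩
      g (i + h)                 ≡⟨ anti i ⟩
      ℚ.- g i                   ∎

    rearrange : ∀ i p r m → i + (p + (r + m)) ≡ i + r + m + p
    rearrange = solve-∀

    vanish : ∀ i → blockBoundary r s t g i ≡ 0ℚ
    vanish i = begin
      (g i ℚ.- g (i + r)) ℚ.+ (g (i + (r + t)) ℚ.- g (i + (r + t + s)))
        ≡⟨ cong₂ (λ x y → (g i ℚ.- g (i + r)) ℚ.+ (x ℚ.- y)) (shift-r+t i)
             (begin
               g (i + (r + t + s))       ≡⟨ cong (λ k → g (i + (r + t + k))) s≡ ⟩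
               g (i + (r + t + (r + m))) ≡⟨ cong g (rearrange i (r + t) r m) ⟩
               g (i + r + m + (r + t))   ≡⟨ shift-r+t (i + r + m) ⟩
               ℚ.- g (i + r + m)         ≡⟨ cong ℚ.-_ (∣-period per 2h∣m (i + r)) ⟩
               ℚ.- g (i + r)             ∎) ⟩
      (g i ℚ.- g (i + r)) ℚ.+ (ℚ.- g i ℚ.- (ℚ.- g (i + r)))
        ≡⟨ solve 2 (λ x y → (x :- y) :+ (:- x :- (:- y)) := con 0ℚ) refl (g i) (g (i + r)) ⟩
      0ℚ ∎
      where open +-*-Solver

lemma24 : ∀ (n r s t : ℕ) .{{_ : NonZero n}} → r + s + t ≤ n →
    ( 1 < gcd n (gcd s r)
    ⊎ ( gcd n s ≡ 1
    × ( (∃[ d ] (+ 2 ℤ.≤ d × d ∣ + n × d ∣ + t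
    × ∃[ ℓ ] (0 < ℓ × s ≡ ℓ * r × + ℓ ≡[mod d ] -1ℤ)))
    ⊎ ( Even (+ n)
    × ∃[ d ] (Even d × d ∣ + n
    × ∃[ k ] (Odd k × + (r + t) ≡ k ℤ.* (d ℤ./ + 2))
    × ∃[ ℓ ] (0 < ℓ × s ≡ ℓ * r × + ℓ ≡[mod d ] 1ℤ)))))) →
    Singular (elementCirculantDigraph n r s t)
lemma24 n r s t bound (inj₁ 1<gcd) = gcd-singular {r = r} {s} bound 1<gcd
lemma24 n r s t bound
  (inj₂ (_ , inj₁ (+ d , ℤ.+≤+ 1<d , d∣n , d∣t , ℓ , _ , s≡ℓr , d∣ℓ+1))) =
  ∣t-∣r+s-singular {r = r} {s} bound 1<d d∣n d∣t
    -- The number r + ℓr is (1 + ℓ)r by computation, and ℓ ≡ -1 says that `d` divides ℓ + 1.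
    (subst (λ k → d ℕ.∣ r + k) (sym s≡ℓr)
      (ℕ.∣m⇒∣m*n r (subst (d ℕ.∣_) (ℕ.+-comm ℓ 1) d∣ℓ+1)))
lemma24 n r s t bound
  (inj₂ (_ , inj₂ (_ , d , 2∣d , d∣n , k , (2∤k , r+t≡) , suc m , _ , s≡ℓr , d∣m)))
  with q , ∣k∣≡ ← 2∤⇒≡1+q*2 2∤k =
  -- With ℓ = 1 + m, the product ℓr computes to r + mr and ℓ ≡ 1 becomes d ∣ m, so the surplus mr is
  -- a multiple of `d`.
  odd-multiple-singular {r = r} {s} bound (subst (ℕ._∣ n) ∣d∣≡ d∣n) q (m * r) r+t≡′ s≡ℓr
    (ℕ.∣m⇒∣m*n r (subst (ℕ._∣ m) ∣d∣≡ d∣m))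
  where
  h = ℤ.∣ d ℤ./ + 2 ∣

  double : ∀ h → h * 2 ≡ h + h
  double = solve-∀

  ∣d∣≡ : ℤ.∣ d ∣ ≡ h + h
  ∣d∣≡ = trans (even⇒∣d∣≡∣d/2∣*2 d 2∣d) (double h)

  instance
    h≢0 : NonZero h
    -- If `h` were 0, then `d` would be 0 as well, and 0 does not divide the nonzero `n`.
    h≢0 = ≢-nonZero λ h≡0 → ≢-nonZero⁻¹ n
      (ℕ.0∣⇒≡0 (subst (ℕ._∣ n) (trans ∣d∣≡ (cong (λ i → i + i) h≡0)) d∣n))

  expand : ∀ q h → (1 + q * 2) * h ≡ h + q * (h + h)
  expand = solve-∀

  r+t≡′ : r + t ≡ h + q * (h + h)
  -- As `r + t` is a natural number, taking absolute values removes the signs of `k` and of d/2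
  -- without changing the left side.
  r+t≡′ = trans (trans (cong ℤ.∣_∣ r+t≡) (ℤ.abs-* k (d ℤ./ + 2)))
    (trans (cong (_* h) ∣k∣≡) (expand q h))
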